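{- Let $G_1$ and $G_2$ be two vertex-disjoint simple connected graphs with $|V(G_1)|=n_1$, $|V(G_2)|=n_2$, $|E(G_1)|=m_1$, $|E(G_2)|=m_2$. Then the edge Q-join $G_1\underline{\vee}_Q G_2$ satisfies \[ F(G_1\underline{\vee}_Q G_2)=F(G_1)+F(G_2)+3n_2^{2}M_1(G_1)+3m_1M_1(G_2)+M_4(G_1)+3n_2\,HM(G_1)+3\,ReZM(G_1)+m_1^{2}(6m_2+m_1n_2)+m_1n_2^{3}. \]
   Context: For a simple graph $G$ and $v\in V(G)$, $d_G(v)$ is the degree of $v$. Define $M_1(G)=\sum_{v\in V(G)}d_G(v)^2$, $F(G)=\sum_{v\in V(G)}d_G(v)^3$, $M_4(G)=\sum_{v\in V(G)}d_G(v)^4$, $HM(G)=\sum_{uv\in E(G)}[d_G(u)+d_G(v)]^2$, and $ReZM(G)=\sum_{uv\in E(G)}d_G(u)d_G(v)\,[d_G(u)+d_G(v)]$. The graph $Q(G)$ is obtained from $G$ by inserting a new vertex into each edge of $G$ (subdividing it) and then joining by an edge each pair of new vertices that lie on adjacent edges of $G$ (edges sharing an end vertex); let $I(G)$ denote the set of these new vertices, so $V(Q(G))=V(G)\cup I(G)$. The edge Q-join $G_1\underline{\vee}_Q G_2$ is the graph obtained from $Q(G_1)$ and $G_2$ (taken vertex-disjoint) by joining each vertex of $I(G_1)$ to every vertex of $G_2$ by an edge. -}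

module Defs where

open import Data.Empty using (⊥)
open import Data.Fin using (Fin; toℕ)
import Data.Fin.Properties as Fin
open import Data.List using (List; length; filter; map; tabulate; lookup; cartesianProduct)
open import Data.Nat using (ℕ; _+_; _*_; _^_; _<?_)
open import Data.Nat.ListAction using (sum)
open import Data.Product using (_×_; _,_; ∃-syntax; proj₁; proj₂)
open import Data.Sum using (_⊎_; inj₁; inj₂; [_,_]′)
open import Data.Sum.Function.Propositional using (_⊎-↔_)
open import Data.Unit using (⊤)
open import Function using (_↔_; Inverse)
open import Function.Properties.Inverse using (↔-refl; ↔-sym; ↔-trans; ↔⇒↣)
open import Level using (0ℓ)
open import Relation.Binary.Core using (Rel)
open import Relation.Binary.Construct.Closure.ReflexiveTransitive using (Star)
open import Relation.Binary.Definitions using (Decidable; DecidableEquality; Irreflexive; Symmetric)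
open import Relation.Binary.PropositionalEquality using (_≡_; _≢_; refl; sym)
open import Relation.Nullary using (Dec; yes; no; ¬?)
open import Relation.Nullary.Decidable using (map′; _×-dec_; _⊎-dec_; via-injection)

record SimpleGraph : Set₁ where
  field
    Vertex     : Set
    order      : ℕ
    labelling  : Fin order ↔ Vertex
    Adj        : Rel Vertex 0ℓ
    Adj?       : Decidable Adj
    Adj-sym    : Symmetric Adj
    Adj-irrefl : Irreflexive _≡_ Adj

  vertices : List Vertex
  vertices = tabulate (Inverse.to labelling)

  label : Vertex → ℕ
  label v = toℕ (Inverse.from labelling v)

  _≟ᵥ_ : DecidableEquality Vertex
  _≟ᵥ_ = via-injection (↔⇒↣ (↔-sym labelling)) Fin._≟_

  degree : Vertex → ℕ
  degree v = length (filter (Adj? v) vertices)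

  -- Each edge is listed once, as the pair of its ends with the smaller label first.
  edges : List (Vertex × Vertex)
  edges = filter (λ (u , v) → (label u <? label v) ×-dec Adj? u v)
                 (cartesianProduct vertices vertices)

  size : ℕ
  size = length edges

  Edge : Set
  Edge = Fin size

  ends : Edge → Vertex × Vertex
  ends = lookup edges

  _isEndOf_ : Vertex → Edge → Set
  v isEndOf e = v ≡ proj₁ (ends e) ⊎ v ≡ proj₂ (ends e)

  _isEndOf?_ : Decidable _isEndOf_
  v isEndOf? e = (v ≟ᵥ proj₁ (ends e)) ⊎-dec (v ≟ᵥ proj₂ (ends e))

  AdjacentEdges : Rel Edge 0ℓ
  AdjacentEdges e f = e ≢ f × ∃[ w ] (w isEndOf e × w isEndOf f)

  AdjacentEdges? : Decidable AdjacentEdges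
  AdjacentEdges? e f = ¬? (e Fin.≟ f) ×-dec
    map′ [ (λ p → _ , inj₁ refl , p) , (λ p → _ , inj₂ refl , p) ]′
         (λ { (_ , inj₁ refl , p) → inj₁ p ; (_ , inj₂ refl , p) → inj₂ p })
         ((proj₁ (ends e) isEndOf? f) ⊎-dec (proj₂ (ends e) isEndOf? f))

  Connected : Set
  Connected = ∀ u v → Star Adj u v

  ∑ᵥ : (Vertex → ℕ) → ℕ
  ∑ᵥ f = sum (map f vertices)

  ∑ₑ : (Vertex → Vertex → ℕ) → ℕ
  ∑ₑ f = sum (map (λ (u , v) → f u v) edges)

open SimpleGraph

M₁ F M₄ HM ReZM : SimpleGraph → ℕ
M₁ G = ∑ᵥ G λ v → degree G v ^ 2
F  G = ∑ᵥ G λ v → degree G v ^ 3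
M₄ G = ∑ᵥ G λ v → degree G v ^ 4
HM G = ∑ₑ G λ u v → (degree G u + degree G v) ^ 2
ReZM G = ∑ₑ G λ u v → degree G u * degree G v * (degree G u + degree G v)

-- `inj₂ e` is the new vertex inserted into the edge e.
module _ (G : SimpleGraph) where

  QVertex : Set
  QVertex = Vertex G ⊎ Edge G

  QAdj : Rel QVertex 0ℓ
  QAdj (inj₁ u) (inj₁ v) = ⊥
  QAdj (inj₁ v) (inj₂ e) = _isEndOf_ G v e
  QAdj (inj₂ e) (inj₁ v) = _isEndOf_ G v e
  QAdj (inj₂ e) (inj₂ f) = AdjacentEdges G e f

  QAdj? : Decidable QAdj
  QAdj? (inj₁ u) (inj₁ v) = no λ ()
  QAdj? (inj₁ v) (inj₂ e) = _isEndOf?_ G v e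
  QAdj? (inj₂ e) (inj₁ v) = _isEndOf?_ G v e
  QAdj? (inj₂ e) (inj₂ f) = AdjacentEdges? G e f

  QAdj-sym : Symmetric QAdj
  QAdj-sym {inj₁ v} {inj₂ e} p = p
  QAdj-sym {inj₂ e} {inj₁ v} p = p
  QAdj-sym {inj₂ e} {inj₂ f} (e≢f , w , p , q) = (λ f≡e → e≢f (sym f≡e)) , w , q , p

  QAdj-irrefl : Irreflexive _≡_ QAdj
  QAdj-irrefl {inj₂ e} refl (e≢e , _) = e≢e refl

  Q : SimpleGraph
  Q = record
    { Vertex     = QVertex
    ; order      = order G + size G
    ; labelling  = ↔-trans Fin.+↔⊎ (labelling G ⊎-↔ ↔-refl)
    ; Adj        = QAdj
    ; Adj?       = QAdj?
    ; Adj-sym    = λ {x} {y} → QAdj-sym {x} {y}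
    ; Adj-irrefl = QAdj-irrefl
    }

  _∈I : QVertex → Set
  inj₁ v ∈I = ⊥
  inj₂ e ∈I = ⊤

  _∈I? : ∀ x → Dec (x ∈I)
  inj₁ v ∈I? = no λ ()
  inj₂ e ∈I? = yes _

module _ (G₁ G₂ : SimpleGraph) where

  JoinVertex : Set
  JoinVertex = Vertex (Q G₁) ⊎ Vertex G₂

  JoinAdj : Rel JoinVertex 0ℓ
  JoinAdj (inj₁ x) (inj₁ y) = Adj (Q G₁) x y
  JoinAdj (inj₁ x) (inj₂ v) = _∈I G₁ x
  JoinAdj (inj₂ v) (inj₁ x) = _∈I G₁ x
  JoinAdj (inj₂ u) (inj₂ v) = Adj G₂ u v

  JoinAdj? : Decidable JoinAdj
  JoinAdj? (inj₁ x) (inj₁ y) = Adj? (Q G₁) x y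
  JoinAdj? (inj₁ x) (inj₂ v) = _∈I? G₁ x
  JoinAdj? (inj₂ v) (inj₁ x) = _∈I? G₁ x
  JoinAdj? (inj₂ u) (inj₂ v) = Adj? G₂ u v

  JoinAdj-sym : Symmetric JoinAdj
  JoinAdj-sym {inj₁ x} {inj₁ y} p = Adj-sym (Q G₁) {x} {y} p
  JoinAdj-sym {inj₁ x} {inj₂ v} p = p
  JoinAdj-sym {inj₂ v} {inj₁ x} p = p
  JoinAdj-sym {inj₂ u} {inj₂ v} p = Adj-sym G₂ p

  JoinAdj-irrefl : Irreflexive _≡_ JoinAdj
  JoinAdj-irrefl {inj₁ x} refl p = Adj-irrefl (Q G₁) {x} refl p
  JoinAdj-irrefl {inj₂ v} refl p = Adj-irrefl G₂ refl p

  infix 7 _∨Q_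

  _∨Q_ : SimpleGraph
  _∨Q_ = record
    { Vertex     = JoinVertex
    ; order      = order (Q G₁) + order G₂
    ; labelling  = ↔-trans Fin.+↔⊎ (labelling (Q G₁) ⊎-↔ labelling G₂)
    ; Adj        = JoinAdj
    ; Adj?       = JoinAdj?
    ; Adj-sym    = λ {x} {y} → JoinAdj-sym {x} {y}
    ; Adj-irrefl = JoinAdj-irrefl
    }

{-# OPTIONS --safe #-}
module Submission where

-- Every vertex of the edge Q-join has an explicit degree: a vertex v of G₁ keeps d(v), the new
-- vertex on the edge uv of G₁ has d(u) + d(v) + n₂, and a vertex v of G₂ has d(v) + m₁. Expanding
-- the cubes and converting edge sums to vertex sums by the weighted handshake identity
-- Σᵥ d(v) f(v) = Σ_{uv} (f(u) + f(v)) gives the formula. The degrees in Q(G₁) come from indicator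
-- sums, using the same identity with f the indicator of a vertex.

open import Data.Bool using (true; false; if_then_else_)
open import Data.Fin using (Fin; zero; suc; splitAt)
import Data.Fin.Properties as Fin
open import Data.List using (List; []; _∷_; _++_; length; filter; map; tabulate; lookup; allFin; cartesianProduct)
open import Data.List.Properties using (map-++; map-∘; map-tabulate; tabulate-cong; tabulate-lookup; length-tabulate)
open import Data.List.Membership.Propositional using (_∈_)
open import Data.List.Membership.Propositional.Properties using (∈-filter⁻; ∈-lookup; ∈-tabulate⁺)
open import Data.List.Relation.Unary.All as All using ()
open import Data.List.Relation.Unary.AllPairs using (_∷_)
open import Data.List.Relation.Unary.Any using (here; there)
open import Data.List.Relation.Unary.Unique.Propositional using (Unique)
import Data.List.Relation.Unary.Unique.Propositional.Properties as Unique
open import Data.Nat using (ℕ; zero; suc; _+_; _*_; _^_; _<_; _<?_)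
open import Data.Nat.ListAction using (sum)
open import Data.Nat.ListAction.Properties using (sum-++)
open import Data.Nat.Properties using (+-comm; +-identityʳ; *-zeroʳ; *-identityʳ; *-comm; *-distribˡ-+; *-distribʳ-+; <-asym; <-irrefl; <-cmp)
open import Data.Nat.Solver using (module +-*-Solver)
open import Data.Nat.Tactic.RingSolver using (solve-∀)
open import Data.Product using (_×_; _,_; proj₁; proj₂)
open import Data.Sum as Sum using (_⊎_; inj₁; inj₂)
open import Data.Unit using (tt)
open import Level using (0ℓ)
open import Function using (_∘_; _⇔_; mk⇔; const; Inverse; Injection)
open import Function.Properties.Inverse using (↔⇒↣; ↔-sym)
open import Relation.Binary.Definitions using (DecidableEquality; tri<; tri≈; tri>)
open import Relation.Binary.PropositionalEquality using (_≡_; _≢_; refl; sym; trans; cong; cong₂; subst; subst₂; module ≡-Reasoning)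
open import Relation.Nullary using (Dec; does; yes; no; ¬_; contradiction)
open import Relation.Nullary.Decidable using (_×-dec_; _⊎-dec_; does-⇔)
open import Relation.Unary using (Pred; Decidable)
open import Defs

-- Finite sums over lists and 0/1 indicators.

private variable
  A B : Set

∑ : List A → (A → ℕ) → ℕ
∑ xs f = sum (map f xs)

𝟙 : Dec A → ℕ
𝟙 P? = if does P? then 1 else 0

𝟙-cong : A ⇔ B → (P? : Dec A) (Q? : Dec B) → 𝟙 P? ≡ 𝟙 Q?
𝟙-cong P⇔Q P? Q? = cong (if_then 1 else 0) (does-⇔ P⇔Q P? Q?)

𝟙-true : (P? : Dec A) → A → 𝟙 P? ≡ 1
𝟙-true P? p = 𝟙-cong (mk⇔ (const tt) (const p)) P? (yes tt)

𝟙-false : (P? : Dec A) → ¬ A → 𝟙 P? ≡ 0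
𝟙-false (yes p) ¬p = contradiction p ¬p
𝟙-false (no _)  _  = refl

-- Inclusion-exclusion for two events. Keeping the intersection on the left avoids truncated
-- subtraction. It is applied both to exclusive events and to the two ends of one edge lying on
-- another.
𝟙-⊎-× : (P? : Dec A) (Q? : Dec B) → 𝟙 (P? ⊎-dec Q?) + 𝟙 (P? ×-dec Q?) ≡ 𝟙 P? + 𝟙 Q?
𝟙-⊎-× (yes _) (yes _) = refl
𝟙-⊎-× (yes _) (no _)  = refl
𝟙-⊎-× (no _)  (yes _) = refl
𝟙-⊎-× (no _)  (no _)  = refl

𝟙-⊎ : (P? : Dec A) (Q? : Dec B) → ¬ (A × B) → 𝟙 (P? ⊎-dec Q?) ≡ 𝟙 P? + 𝟙 Q?
𝟙-⊎ P? Q? disjoint = begin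
  𝟙 (P? ⊎-dec Q?)                     ≡⟨ +-identityʳ _ ⟨
  𝟙 (P? ⊎-dec Q?) + 0                 ≡⟨ cong (𝟙 (P? ⊎-dec Q?) +_) (𝟙-false (P? ×-dec Q?) disjoint) ⟨
  𝟙 (P? ⊎-dec Q?) + 𝟙 (P? ×-dec Q?)   ≡⟨ 𝟙-⊎-× P? Q? ⟩
  𝟙 P? + 𝟙 Q?                         ∎
  where open ≡-Reasoning

∑-cong-∈ : ∀ (xs : List A) {f g} → (∀ {x} → x ∈ xs → f x ≡ g x) → ∑ xs f ≡ ∑ xs g
∑-cong-∈ []       eq = refl
∑-cong-∈ (x ∷ xs) eq = cong₂ _+_ (eq (here refl)) (∑-cong-∈ xs (eq ∘ there))

∑-cong : ∀ (xs : List A) {f g} → (∀ x → f x ≡ g x) → ∑ xs f ≡ ∑ xs g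
∑-cong xs eq = ∑-cong-∈ xs (λ {x} _ → eq x)

∑-const : ∀ (xs : List A) c → ∑ xs (const c) ≡ length xs * c
∑-const []       c = refl
∑-const (x ∷ xs) c = cong (c +_) (∑-const xs c)

∑-zero : ∀ (xs : List A) {f} → (∀ {x} → x ∈ xs → f x ≡ 0) → ∑ xs f ≡ 0
∑-zero xs f≡0 = trans (∑-cong-∈ xs f≡0) (trans (∑-const xs 0) (*-zeroʳ (length xs)))

∑-+ : ∀ (xs : List A) (f g : A → ℕ) → ∑ xs (λ x → f x + g x) ≡ ∑ xs f + ∑ xs g
∑-+ []       f g = refl
∑-+ (x ∷ xs) f g = trans (cong (f x + g x +_) (∑-+ xs f g)) (interchange (f x) (g x) _ _)
  where
  interchange : ∀ a b c d → a + b + (c + d) ≡ a + c + (b + d)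
  interchange = solve-∀

∑-*ˡ : ∀ (xs : List A) c (f : A → ℕ) → ∑ xs (λ x → c * f x) ≡ c * ∑ xs f
∑-*ˡ []       c f = sym (*-zeroʳ c)
∑-*ˡ (x ∷ xs) c f = trans (cong (c * f x +_) (∑-*ˡ xs c f)) (sym (*-distribˡ-+ c (f x) _))

∑-*ʳ : ∀ (xs : List A) (f : A → ℕ) c → ∑ xs (λ x → f x * c) ≡ ∑ xs f * c
∑-*ʳ xs f c = begin
  ∑ xs (λ x → f x * c)  ≡⟨ ∑-cong xs (λ x → *-comm (f x) c) ⟩
  ∑ xs (λ x → c * f x)  ≡⟨ ∑-*ˡ xs c f ⟩
  c * ∑ xs f            ≡⟨ *-comm c _ ⟩
  ∑ xs f * c            ∎
  where
  open ≡-Reasoning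

∑-swap : ∀ (xs : List A) (ys : List B) (f : A → B → ℕ) →
         ∑ xs (λ x → ∑ ys (f x)) ≡ ∑ ys (λ y → ∑ xs (λ x → f x y))
∑-swap []       ys f = sym (∑-zero ys (const refl))
∑-swap (x ∷ xs) ys f = begin
  ∑ ys (f x) + ∑ xs (λ x → ∑ ys (f x))          ≡⟨ cong (∑ ys (f x) +_) (∑-swap xs ys f) ⟩
  ∑ ys (f x) + ∑ ys (λ y → ∑ xs (λ x → f x y))  ≡⟨ ∑-+ ys (f x) _ ⟨
  ∑ ys (λ y → f x y + ∑ xs (λ x → f x y))       ∎
  where open ≡-Reasoning

∑-++ : ∀ (xs ys : List A) f → ∑ (xs ++ ys) f ≡ ∑ xs f + ∑ ys f
∑-++ xs ys f = trans (cong sum (map-++ f xs ys)) (sum-++ (map f xs) (map f ys))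

∑-map : ∀ (g : A → B) xs (f : B → ℕ) → ∑ (map g xs) f ≡ ∑ xs (f ∘ g)
∑-map g xs f = cong sum (sym (map-∘ xs))

∑-cartesianProduct : ∀ (xs : List A) (ys : List B) (f : A × B → ℕ) →
                     ∑ (cartesianProduct xs ys) f ≡ ∑ xs (λ x → ∑ ys (λ y → f (x , y)))
∑-cartesianProduct []       ys f = refl
∑-cartesianProduct (x ∷ xs) ys f = trans (∑-++ (map (x ,_) ys) _ f)
  (cong₂ _+_ (∑-map (x ,_) ys f) (∑-cartesianProduct xs ys f))

∑-filter : ∀ {P : Pred A 0ℓ} (P? : Decidable P) xs (f : A → ℕ) →
           ∑ (filter P? xs) f ≡ ∑ xs (λ x → 𝟙 (P? x) * f x)
∑-filter P? []       f = refl
∑-filter P? (x ∷ xs) f with does (P? x)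
... | true  = cong₂ _+_ (sym (+-identityʳ (f x))) (∑-filter P? xs f)
... | false = ∑-filter P? xs f

length-filter : ∀ {P : Pred A 0ℓ} (P? : Decidable P) xs → length (filter P? xs) ≡ ∑ xs (𝟙 ∘ P?)
length-filter P? []       = refl
length-filter P? (x ∷ xs) with does (P? x)
... | true  = cong suc (length-filter P? xs)
... | false = length-filter P? xs

-- The sifting property of the Kronecker delta: membership supplies a surviving term, and uniqueness
-- of the list prevents a second one.
∑-𝟙-≟ : ∀ (_≟_ : DecidableEquality A) {xs v} → Unique xs → v ∈ xs →
        ∀ (f : A → ℕ) → ∑ xs (λ x → f x * 𝟙 (v ≟ x)) ≡ f v
∑-𝟙-≟ _≟_ {x ∷ xs} (x∉xs ∷ _) (here refl) f = begin
  f x * 𝟙 (x ≟ x) + ∑ xs (λ y → f y * 𝟙 (x ≟ y))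
    ≡⟨ cong₂ _+_ (cong (f x *_) (𝟙-true (x ≟ x) refl)) (∑-zero xs λ {y} y∈xs →
         trans (cong (f y *_) (𝟙-false (x ≟ y) (All.lookup x∉xs y∈xs))) (*-zeroʳ (f y))) ⟩
  f x * 1 + 0
    ≡⟨ trans (+-identityʳ _) (*-identityʳ _) ⟩
  f x ∎
  where open ≡-Reasoning
∑-𝟙-≟ _≟_ {x ∷ xs} {v} (x∉xs ∷ xs!) (there v∈xs) f = cong₂ _+_
  (trans (cong (f x *_) (𝟙-false (v ≟ x) λ v≡x → All.lookup x∉xs v∈xs (sym v≡x))) (*-zeroʳ (f x)))
  (∑-𝟙-≟ _≟_ xs! v∈xs f)

-- New vertices of `Q G` are positions in the list `edges`, so their contributions first appear as
-- sums over `allFin`; this turns them into sums over the edges themselves.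
∑-lookup : ∀ (xs : List A) (f : A → ℕ) → ∑ (allFin (length xs)) (f ∘ lookup xs) ≡ ∑ xs f
∑-lookup xs f = cong sum (begin
  map (f ∘ lookup xs) (allFin (length xs))  ≡⟨ map-tabulate (λ i → i) (f ∘ lookup xs) ⟩
  tabulate (f ∘ lookup xs)                  ≡⟨ map-tabulate (lookup xs) f ⟨
  map f (tabulate (lookup xs))              ≡⟨ cong (map f) (tabulate-lookup xs) ⟩
  map f xs                                  ∎)
  where open ≡-Reasoning

lookup-injective : ∀ {xs : List A} → Unique xs → ∀ i j → lookup xs i ≡ lookup xs j → i ≡ j
lookup-injective (_ ∷ _)     zero    zero    eq = refl
lookup-injective (x∉xs ∷ _)  zero    (suc j) eq = contradiction eq (All.lookup x∉xs (∈-lookup j))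
lookup-injective (x∉xs ∷ _)  (suc i) zero    eq = contradiction (sym eq) (All.lookup x∉xs (∈-lookup i))
lookup-injective (_ ∷ xs!)   (suc i) (suc j) eq = cong suc (lookup-injective xs! i j eq)

-- Both `Q` and `_∨Q_` label a disjoint union through `splitAt`, so their vertex lists have this
-- shape. The outer `h` allows use after `map` has been fused into `tabulate`.
tabulate-splitAt : ∀ m {n} {C : Set} (f : Fin m → A) (g : Fin n → B) (h : A ⊎ B → C) →
                   tabulate (h ∘ Sum.map f g ∘ splitAt m) ≡ tabulate (h ∘ inj₁ ∘ f) ++ tabulate (h ∘ inj₂ ∘ g)
tabulate-splitAt zero    f g h = refl
tabulate-splitAt (suc m) f g h = cong (h (inj₁ (f zero)) ∷_) (begin
  tabulate (h ∘ Sum.map f g ∘ splitAt (suc m) ∘ suc)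
    ≡⟨ tabulate-cong (λ i → shift (splitAt m i)) ⟩
  tabulate (h ∘ Sum.map (f ∘ suc) g ∘ splitAt m)
    ≡⟨ tabulate-splitAt m (f ∘ suc) g h ⟩
  tabulate (h ∘ inj₁ ∘ f ∘ suc) ++ tabulate (h ∘ inj₂ ∘ g) ∎)
  where
  open ≡-Reasoning
  -- `splitAt (suc m) (suc i)` reduces to `Sum.map₁ suc (splitAt m i)`; the added `suc` is absorbed
  -- into `f`.
  shift : ∀ s → h (Sum.map f g (Sum.map₁ suc s)) ≡ h (Sum.map (f ∘ suc) g s)
  shift (inj₁ _) = refl
  shift (inj₂ _) = refl

∑-tabulate-splitAt : ∀ m {n} (f : Fin m → A) (g : Fin n → B) (h : A ⊎ B → ℕ) →
                     ∑ (tabulate (Sum.map f g ∘ splitAt m)) h ≡ ∑ (tabulate f) (h ∘ inj₁) + ∑ (tabulate g) (h ∘ inj₂)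
∑-tabulate-splitAt m f g h = begin
  sum (map h (tabulate (Sum.map f g ∘ splitAt m)))
    ≡⟨ cong sum (trans (map-tabulate _ h) (tabulate-splitAt m f g h)) ⟩
  sum (tabulate (h ∘ inj₁ ∘ f) ++ tabulate (h ∘ inj₂ ∘ g))
    ≡⟨ sum-++ (tabulate (h ∘ inj₁ ∘ f)) _ ⟩
  sum (tabulate (h ∘ inj₁ ∘ f)) + sum (tabulate (h ∘ inj₂ ∘ g))
    ≡⟨ cong₂ (λ xs ys → sum xs + sum ys) (map-tabulate f (h ∘ inj₁)) (map-tabulate g (h ∘ inj₂)) ⟨
  ∑ (tabulate f) (h ∘ inj₁) + ∑ (tabulate g) (h ∘ inj₂) ∎
  where open ≡-Reasoning

-- Edge sums as vertex sums, and the weighted handshake identity.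

module _ (G : SimpleGraph) where
  open SimpleGraph G

  label-injective : ∀ {u v} → label u ≡ label v → u ≡ v
  label-injective = Injection.injective (↔⇒↣ (↔-sym labelling)) ∘ Fin.toℕ-injective

  vertices-unique : Unique vertices
  vertices-unique = Unique.tabulate⁺ (Injection.injective (↔⇒↣ labelling))

  ∈-vertices : ∀ v → v ∈ vertices
  ∈-vertices v = subst (_∈ vertices) (Inverse.strictlyInverseˡ labelling v)
    (∈-tabulate⁺ (Inverse.from labelling v))

  edges-unique : Unique edges
  edges-unique = Unique.filter⁺ _ (Unique.cartesianProduct⁺ vertices-unique vertices-unique)

  length-vertices : length vertices ≡ order
  length-vertices = length-tabulate (Inverse.to labelling)

  degree-∑ : ∀ v → degree v ≡ ∑ᵥ (𝟙 ∘ Adj? v)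
  degree-∑ v = length-filter (Adj? v) vertices

  private
    Oriented? : ∀ u v → Dec (label u < label v × Adj u v)
    Oriented? u v = (label u <? label v) ×-dec Adj? u v

  -- Labels are linearly ordered, so an adjacent pair is oriented in exactly one direction; equal
  -- labels would give a loop. This reconciles symmetric adjacency with `edges`, which lists each
  -- edge once.
  𝟙-Adj : ∀ u v → 𝟙 (Adj? u v) ≡ 𝟙 (Oriented? u v) + 𝟙 (Oriented? v u)
  𝟙-Adj u v = trans (𝟙-cong (mk⇔ orient Sum.[ proj₂ , Adj-sym ∘ proj₂ ]) (Adj? u v) (Oriented? u v ⊎-dec Oriented? v u))
    (𝟙-⊎ (Oriented? u v) (Oriented? v u) λ ((u<v , _) , (v<u , _)) → <-asym u<v v<u)
    where
    orient : Adj u v → (label u < label v × Adj u v) ⊎ (label v < label u × Adj v u)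
    orient uv with <-cmp (label u) (label v)
    ... | tri< u<v _ _ = inj₁ (u<v , uv)
    ... | tri≈ _ u≈v _ = contradiction uv (Adj-irrefl (label-injective u≈v))
    ... | tri> _ _ v<u = inj₂ (v<u , Adj-sym uv)

  ∑ₑ-∑ᵥ : ∀ f → ∑ₑ f ≡ ∑ᵥ λ u → ∑ᵥ λ v → 𝟙 (Oriented? u v) * f u v
  ∑ₑ-∑ᵥ f = trans (∑-filter (λ (u , v) → Oriented? u v) (cartesianProduct vertices vertices) _)
    (∑-cartesianProduct vertices vertices _)

  -- Double counting of incidences: each degree is written as a sum of adjacency indicators, and
  -- each indicator is split into its two orientations.
  handshake : ∀ (f : Vertex → ℕ) → ∑ᵥ (λ v → degree v * f v) ≡ ∑ₑ (λ u v → f u + f v)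
  handshake f = begin
    ∑ᵥ (λ u → degree u * f u)
      ≡⟨ ∑-cong vertices (λ u → trans (cong (_* f u) (degree-∑ u)) (sym (∑-*ʳ vertices _ (f u)))) ⟩
    ∑ᵥ (λ u → ∑ᵥ λ v → 𝟙 (Adj? u v) * f u)
      ≡⟨ ∑-cong vertices (λ u → ∑-cong vertices λ v →
           trans (cong (_* f u) (𝟙-Adj u v)) (*-distribʳ-+ (f u) (𝟙 (Oriented? u v)) _)) ⟩
    ∑ᵥ (λ u → ∑ᵥ λ v → 𝟙 (Oriented? u v) * f u + 𝟙 (Oriented? v u) * f u)
      ≡⟨ trans (∑-cong vertices λ u → ∑-+ vertices _ _) (∑-+ vertices _ _) ⟩
    ∑ᵥ (λ u → ∑ᵥ λ v → 𝟙 (Oriented? u v) * f u) + ∑ᵥ (λ u → ∑ᵥ λ v → 𝟙 (Oriented? v u) * f u)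
      -- Exchanging the two summations in the second half restores the listed orientation, so that
      -- `f` is evaluated at the second end of the edge.
      ≡⟨ cong₂ _+_ (sym (∑ₑ-∑ᵥ λ u v → f u)) (trans (∑-swap vertices vertices _) (sym (∑ₑ-∑ᵥ λ u v → f v))) ⟩
    ∑ₑ (λ u v → f u) + ∑ₑ (λ u v → f v)
      ≡⟨ ∑-+ edges _ _ ⟨
    ∑ₑ (λ u v → f u + f v) ∎
    where
    open ≡-Reasoning

  ∑ᵥ-degree : ∑ᵥ degree ≡ 2 * size
  ∑ᵥ-degree = begin
    ∑ᵥ degree                 ≡⟨ ∑-cong vertices (λ v → *-identityʳ (degree v)) ⟨
    ∑ᵥ (λ v → degree v * 1)   ≡⟨ handshake (const 1) ⟩
    ∑ edges (const 2)         ≡⟨ ∑-const edges 2 ⟩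
    size * 2                  ≡⟨ *-comm size 2 ⟩
    2 * size                  ∎
    where
    open ≡-Reasoning

  -- Incidence and adjacency of edges.

  start end : Edge → Vertex
  start = proj₁ ∘ ends
  end   = proj₂ ∘ ends

  start<end : ∀ e → label (start e) < label (end e)
  start<end e = proj₁ (proj₂ (∈-filter⁻ (λ (u , v) → Oriented? u v) {xs = cartesianProduct vertices vertices} (∈-lookup e)))

  start≢end : ∀ e → start e ≢ end e
  start≢end e eq = <-irrefl (cong label eq) (start<end e)

  ends-injective : ∀ {e f} → ends e ≡ ends f → e ≡ f
  ends-injective = lookup-injective edges-unique _ _

  𝟙-isEndOf : ∀ v e → 𝟙 (v isEndOf? e) ≡ 𝟙 (v ≟ᵥ start e) + 𝟙 (v ≟ᵥ end e)
  𝟙-isEndOf v e = 𝟙-⊎ (v ≟ᵥ start e) (v ≟ᵥ end e) λ (p , q) → start≢end e (trans (sym p) q)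

  -- The number of edges at `v` is its degree: the handshake identity with weight the indicator of
  -- `v` leaves only the term `degree v`.
  ∑-𝟙-isEndOf : ∀ v → ∑ (allFin size) (λ e → 𝟙 (v isEndOf? e)) ≡ degree v
  ∑-𝟙-isEndOf v = begin
    ∑ (allFin size) (λ e → 𝟙 (v isEndOf? e))                      ≡⟨ ∑-cong (allFin size) (𝟙-isEndOf v) ⟩
    ∑ (allFin size) (λ e → 𝟙 (v ≟ᵥ start e) + 𝟙 (v ≟ᵥ end e))     ≡⟨ ∑-lookup edges _ ⟩
    ∑ₑ (λ u w → 𝟙 (v ≟ᵥ u) + 𝟙 (v ≟ᵥ w))                          ≡⟨ handshake (λ u → 𝟙 (v ≟ᵥ u)) ⟨
    ∑ᵥ (λ u → degree u * 𝟙 (v ≟ᵥ u))                              ≡⟨ ∑-𝟙-≟ _≟ᵥ_ vertices-unique (∈-vertices v) degree ⟩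
    degree v                                                      ∎
    where open ≡-Reasoning

  ∑ᵥ-𝟙-isEndOf : ∀ e → ∑ᵥ (λ v → 𝟙 (v isEndOf? e)) ≡ 2
  ∑ᵥ-𝟙-isEndOf e = begin
    ∑ᵥ (λ v → 𝟙 (v isEndOf? e))                                   ≡⟨ ∑-cong vertices (λ v → 𝟙-isEndOf v e) ⟩
    ∑ᵥ (λ v → 𝟙 (v ≟ᵥ start e) + 𝟙 (v ≟ᵥ end e))                  ≡⟨ ∑-+ vertices _ _ ⟩
    ∑ᵥ (λ v → 𝟙 (v ≟ᵥ start e)) + ∑ᵥ (λ v → 𝟙 (v ≟ᵥ end e))       ≡⟨ cong₂ _+_ (once (start e)) (once (end e)) ⟩
    2                                                             ∎
    where
    open ≡-Reasoning
    once : ∀ u → ∑ᵥ (λ v → 𝟙 (v ≟ᵥ u)) ≡ 1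
    once u = trans
      (∑-cong vertices λ v → trans (𝟙-cong (mk⇔ sym sym) (v ≟ᵥ u) (u ≟ᵥ v)) (sym (+-identityʳ _)))
      (∑-𝟙-≟ _≟ᵥ_ vertices-unique (∈-vertices u) (const 1))

  -- Simplicity enters here: the list `edges` has no repetitions, so an edge is determined by its
  -- ordered pair of ends.
  both-ends : ∀ e f → (start e isEndOf f × end e isEndOf f) ⇔ e ≡ f
  both-ends e f = mk⇔ to λ { refl → inj₁ refl , inj₂ refl }
    where
    to : start e isEndOf f × end e isEndOf f → e ≡ f
    to (inj₁ p , inj₁ q) = contradiction (trans p (sym q)) (start≢end e)
    to (inj₁ p , inj₂ q) = ends-injective (cong₂ _,_ p q)
    -- The crossed matching would reverse the label order of the ends of `f`.
    to (inj₂ p , inj₁ q) = contradiction (start<end f)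
      (<-asym (subst₂ _<_ (cong label p) (cong label q) (start<end e)))
    to (inj₂ p , inj₂ q) = contradiction (trans p (sym q)) (start≢end e)

  -- `AdjacentEdges` excludes `e` itself, although `e` shares ends with itself; the summand `e ≡ f`
  -- restores that case.
  either-end : ∀ e f → (start e isEndOf f ⊎ end e isEndOf f) ⇔ (AdjacentEdges e f ⊎ e ≡ f)
  either-end e f = mk⇔ to from
    where
    to : start e isEndOf f ⊎ end e isEndOf f → AdjacentEdges e f ⊎ e ≡ f
    to p with e Fin.≟ f
    ... | yes e≡f = inj₂ e≡f
    ... | no  e≢f = inj₁ (e≢f , Sum.[ (λ q → _ , inj₁ refl , q) , (λ q → _ , inj₂ refl , q) ] p)
    from : AdjacentEdges e f ⊎ e ≡ f → start e isEndOf f ⊎ end e isEndOf f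
    from (inj₁ (_ , _ , inj₁ refl , q)) = inj₁ q
    from (inj₁ (_ , _ , inj₂ refl , q)) = inj₂ q
    from (inj₂ refl)                    = inj₁ (inj₁ refl)

  -- Inclusion–exclusion: two ends of e lie on f only if f = e.
  𝟙-AdjacentEdges : ∀ e f → 𝟙 (AdjacentEdges? e f) + 2 * 𝟙 (e Fin.≟ f)
                          ≡ 𝟙 (start e isEndOf? f) + 𝟙 (end e isEndOf? f)
  𝟙-AdjacentEdges e f = begin
    𝟙 adj? + 2 * 𝟙 (e Fin.≟ f)
      ≡⟨ regroup (𝟙 adj?) (𝟙 (e Fin.≟ f)) ⟩
    (𝟙 adj? + 𝟙 (e Fin.≟ f)) + 𝟙 (e Fin.≟ f)
      ≡⟨ cong₂ _+_
           (trans (sym (𝟙-⊎ adj? (e Fin.≟ f) λ ((e≢f , _) , e≡f) → e≢f e≡f))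
                  (sym (𝟙-cong (either-end e f) (s? ⊎-dec t?) (adj? ⊎-dec e Fin.≟ f))))
           (sym (𝟙-cong (both-ends e f) (s? ×-dec t?) (e Fin.≟ f))) ⟩
    𝟙 (s? ⊎-dec t?) + 𝟙 (s? ×-dec t?)
      ≡⟨ 𝟙-⊎-× s? t? ⟩
    𝟙 s? + 𝟙 t? ∎
    where
    open ≡-Reasoning
    adj? = AdjacentEdges? e f
    s?   = start e isEndOf? f
    t?   = end e isEndOf? f
    regroup : ∀ a b → a + 2 * b ≡ a + b + b
    regroup = solve-∀

  -- Counting the edges at each end of `e` meets every adjacent edge once and `e` itself twice,
  -- whence the `2`.
  ∑-𝟙-AdjacentEdges : ∀ e → ∑ (allFin size) (λ f → 𝟙 (AdjacentEdges? e f)) + 2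
                          ≡ degree (start e) + degree (end e)
  ∑-𝟙-AdjacentEdges e = begin
    ∑ es (λ f → 𝟙 (AdjacentEdges? e f)) + 2
      -- The `2` is rewritten as the sum over `f` of twice the indicator of `e ≡ f`, to be merged
      -- termwise with the adjacency indicators.
      ≡⟨ cong (∑ es (λ f → 𝟙 (AdjacentEdges? e f)) +_)
           (∑-𝟙-≟ Fin._≟_ (Unique.allFin⁺ size) (∈-tabulate⁺ e) (const 2)) ⟨
    ∑ es (λ f → 𝟙 (AdjacentEdges? e f)) + ∑ es (λ f → 2 * 𝟙 (e Fin.≟ f))
      ≡⟨ ∑-+ es _ _ ⟨
    ∑ es (λ f → 𝟙 (AdjacentEdges? e f) + 2 * 𝟙 (e Fin.≟ f))
      ≡⟨ ∑-cong es (𝟙-AdjacentEdges e) ⟩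
    ∑ es (λ f → 𝟙 (start e isEndOf? f) + 𝟙 (end e isEndOf? f))
      ≡⟨ ∑-+ es _ _ ⟩
    ∑ es (λ f → 𝟙 (start e isEndOf? f)) + ∑ es (λ f → 𝟙 (end e isEndOf? f))
      ≡⟨ cong₂ _+_ (∑-𝟙-isEndOf (start e)) (∑-𝟙-isEndOf (end e)) ⟩
    degree (start e) + degree (end e) ∎
    where
    open ≡-Reasoning
    es = allFin size

  -- Degrees in `Q G`.

  ∑ᵥ-Q : ∀ f → SimpleGraph.∑ᵥ (Q G) f ≡ ∑ᵥ (f ∘ inj₁) + ∑ (allFin size) (f ∘ inj₂)
  ∑ᵥ-Q = ∑-tabulate-splitAt order (Inverse.to labelling) (λ e → e)

  degree-Q-vertex : ∀ v → SimpleGraph.degree (Q G) (inj₁ v) ≡ degree v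
  degree-Q-vertex v = begin
    SimpleGraph.degree (Q G) (inj₁ v)
      ≡⟨ length-filter (QAdj? G (inj₁ v)) (SimpleGraph.vertices (Q G)) ⟩
    SimpleGraph.∑ᵥ (Q G) (𝟙 ∘ QAdj? G (inj₁ v))
      ≡⟨ ∑ᵥ-Q _ ⟩
    ∑ᵥ (const 0) + ∑ (allFin size) (λ e → 𝟙 (v isEndOf? e))
      ≡⟨ cong₂ _+_ (∑-zero vertices (const refl)) (∑-𝟙-isEndOf v) ⟩
    degree v ∎
    where open ≡-Reasoning

  -- A new vertex sees the two ends of its edge and the new vertices on adjacent edges. The two ends
  -- exactly make up for `e` having been counted twice in `∑-𝟙-AdjacentEdges`.
  degree-Q-edge : ∀ e → SimpleGraph.degree (Q G) (inj₂ e) ≡ degree (start e) + degree (end e)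
  degree-Q-edge e = begin
    SimpleGraph.degree (Q G) (inj₂ e)
      ≡⟨ length-filter (QAdj? G (inj₂ e)) (SimpleGraph.vertices (Q G)) ⟩
    SimpleGraph.∑ᵥ (Q G) (𝟙 ∘ QAdj? G (inj₂ e))
      ≡⟨ ∑ᵥ-Q _ ⟩
    ∑ᵥ (λ v → 𝟙 (v isEndOf? e)) + ∑ (allFin size) (λ f → 𝟙 (AdjacentEdges? e f))
      ≡⟨ cong (_+ ∑ (allFin size) (λ f → 𝟙 (AdjacentEdges? e f))) (∑ᵥ-𝟙-isEndOf e) ⟩
    2 + ∑ (allFin size) (λ f → 𝟙 (AdjacentEdges? e f))
      ≡⟨ +-comm 2 _ ⟩
    ∑ (allFin size) (λ f → 𝟙 (AdjacentEdges? e f)) + 2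
      ≡⟨ ∑-𝟙-AdjacentEdges e ⟩
    degree (start e) + degree (end e) ∎
    where open ≡-Reasoning

  -- Expansion of the cubic sums.

  ∑ₑ-degree : ∑ₑ (λ u v → degree u + degree v) ≡ M₁ G
  -- `d ^ 2` unfolds to `d * (d * 1)`, hence the correction by `*-identityʳ`.
  ∑ₑ-degree = trans (sym (handshake degree)) (∑-cong vertices λ v → cong (degree v *_) (sym (*-identityʳ _)))

  -- `d ^ 4` unfolds to `d * d ^ 3`, so the handshake identity with cubic weight applies directly.
  ∑ₑ-degree³ : ∑ₑ (λ u v → degree u ^ 3 + degree v ^ 3) ≡ M₄ G
  ∑ₑ-degree³ = sym (handshake λ v → degree v ^ 3)

  -- Contribution of the new vertices, with `n` the order of the second graph. The cube is expanded
  -- in `a + b` and `n`; writing `(a + b) ^ 3` as `a ^ 3 + b ^ 3 + 3 * (a * b * (a + b))` yields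
  -- `M₄` and `ReZM`, while the square and linear terms yield `HM` and `M₁`.
  ∑ₑ-cubes : ∀ n → ∑ₑ (λ u v → (degree u + degree v + n) ^ 3)
                 ≡ M₄ G + 3 * ReZM G + 3 * n * HM G + 3 * n ^ 2 * M₁ G + size * n ^ 3
  ∑ₑ-cubes n = begin
    ∑ₑ (λ u v → (degree u + degree v + n) ^ 3)
      ≡⟨ ∑-cong edges (λ (u , v) → expand (degree u) (degree v) n) ⟩
    ∑ edges (λ e → p e + 3 * q e + 3 * n * r e + 3 * n ^ 2 * s e + n ^ 3)
      ≡⟨ trans (∑-+ edges _ _) (cong (_+ ∑ edges (const (n ^ 3)))
           (trans (∑-+ edges _ _) (cong (_+ ∑ edges (λ e → 3 * n ^ 2 * s e))
           (trans (∑-+ edges _ _) (cong (_+ ∑ edges (λ e → 3 * n * r e)) (∑-+ edges p _)))))) ⟩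
    ∑ edges p + ∑ edges (λ e → 3 * q e) + ∑ edges (λ e → 3 * n * r e)
      + ∑ edges (λ e → 3 * n ^ 2 * s e) + ∑ edges (const (n ^ 3))
      ≡⟨ cong₂ _+_ (cong₂ _+_ (cong₂ _+_ (cong₂ _+_ ∑ₑ-degree³ (∑-*ˡ edges 3 q))
           (∑-*ˡ edges (3 * n) r))
           (trans (∑-*ˡ edges (3 * n ^ 2) s) (cong (3 * n ^ 2 *_) ∑ₑ-degree)))
           (∑-const edges (n ^ 3)) ⟩
    M₄ G + 3 * ReZM G + 3 * n * HM G + 3 * n ^ 2 * M₁ G + size * n ^ 3 ∎
    where
    open ≡-Reasoning
    p q r s : Vertex × Vertex → ℕ
    p (u , v) = degree u ^ 3 + degree v ^ 3
    q (u , v) = degree u * degree v * (degree u + degree v)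
    r (u , v) = (degree u + degree v) ^ 2
    s (u , v) = degree u + degree v
    expand : ∀ a b n → (a + b + n) ^ 3 ≡ a ^ 3 + b ^ 3 + 3 * (a * b * (a + b))
                         + 3 * n * (a + b) ^ 2 + 3 * n ^ 2 * (a + b) + n ^ 3
    expand = solve 3 (λ a b n → (a :+ b :+ n) :^ 3 :=
      a :^ 3 :+ b :^ 3 :+ con 3 :* (a :* b :* (a :+ b))
      :+ con 3 :* n :* (a :+ b) :^ 2 :+ con 3 :* n :^ 2 :* (a :+ b) :+ n :^ 3) refl
      where open +-*-Solver

  -- Contribution of the second graph, each of whose vertices gains `m` neighbours; the linear term
  -- is evaluated by the ordinary handshake lemma.
  ∑ᵥ-cubes : ∀ m → ∑ᵥ (λ v → (degree v + m) ^ 3)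
                 ≡ F G + 3 * m * M₁ G + 3 * m ^ 2 * (2 * size) + order * m ^ 3
  ∑ᵥ-cubes m = begin
    ∑ᵥ (λ v → (degree v + m) ^ 3)
      ≡⟨ ∑-cong vertices (λ v → expand (degree v) m) ⟩
    ∑ᵥ (λ v → degree v ^ 3 + 3 * m * degree v ^ 2 + 3 * m ^ 2 * degree v + m ^ 3)
      ≡⟨ trans (∑-+ vertices _ _) (cong (_+ ∑ᵥ (const (m ^ 3)))
           (trans (∑-+ vertices _ _) (cong (_+ ∑ᵥ (λ v → 3 * m ^ 2 * degree v)) (∑-+ vertices _ _)))) ⟩
    F G + ∑ᵥ (λ v → 3 * m * degree v ^ 2) + ∑ᵥ (λ v → 3 * m ^ 2 * degree v) + ∑ᵥ (const (m ^ 3))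
      ≡⟨ cong₂ _+_ (cong₂ _+_ (cong (F G +_) (∑-*ˡ vertices (3 * m) _))
           (trans (∑-*ˡ vertices (3 * m ^ 2) degree) (cong (3 * m ^ 2 *_) ∑ᵥ-degree)))
           (trans (∑-const vertices (m ^ 3)) (cong (_* m ^ 3) length-vertices)) ⟩
    F G + 3 * m * M₁ G + 3 * m ^ 2 * (2 * size) + order * m ^ 3 ∎
    where
    open ≡-Reasoning
    expand : ∀ d m → (d + m) ^ 3 ≡ d ^ 3 + 3 * m * d ^ 2 + 3 * m ^ 2 * d + m ^ 3
    expand = solve 2 (λ d m → (d :+ m) :^ 3 :=
      d :^ 3 :+ con 3 :* m :* d :^ 2 :+ con 3 :* m :^ 2 :* d :+ m :^ 3) refl
      where open +-*-Solver

-- Degrees and the cubic sum of the edge Q-join.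

module _ (G₁ G₂ : SimpleGraph) where
  private
    module G₁ = SimpleGraph G₁
    module G₂ = SimpleGraph G₂
    module J  = SimpleGraph (G₁ ∨Q G₂)

  ∑ᵥ-∨Q : ∀ f → J.∑ᵥ f ≡ G₁.∑ᵥ (f ∘ inj₁ ∘ inj₁) + ∑ (allFin G₁.size) (f ∘ inj₁ ∘ inj₂) + G₂.∑ᵥ (f ∘ inj₂)
  ∑ᵥ-∨Q f = trans
    (∑-tabulate-splitAt (SimpleGraph.order (Q G₁)) (Inverse.to (SimpleGraph.labelling (Q G₁))) (Inverse.to G₂.labelling) f)
    (cong (_+ G₂.∑ᵥ (f ∘ inj₂)) (∑ᵥ-Q G₁ (f ∘ inj₁)))

  private
    -- Whether `x` is joined to a vertex of `G₂` depends only on `x` being a new vertex, so the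
    -- second sum has a constant summand.
    degree-Q-part : ∀ x → J.degree (inj₁ x) ≡ SimpleGraph.degree (Q G₁) x + G₂.∑ᵥ (const (𝟙 (_∈I? G₁ x)))
    degree-Q-part x = begin
      J.degree (inj₁ x)
        ≡⟨ length-filter (JoinAdj? G₁ G₂ (inj₁ x)) J.vertices ⟩
      J.∑ᵥ (𝟙 ∘ JoinAdj? G₁ G₂ (inj₁ x))
        ≡⟨ ∑-tabulate-splitAt (SimpleGraph.order (Q G₁)) _ _ _ ⟩
      SimpleGraph.∑ᵥ (Q G₁) (𝟙 ∘ QAdj? G₁ x) + G₂.∑ᵥ (const (𝟙 (_∈I? G₁ x)))
        ≡⟨ cong (_+ G₂.∑ᵥ (const (𝟙 (_∈I? G₁ x)))) (length-filter (QAdj? G₁ x) (SimpleGraph.vertices (Q G₁))) ⟨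
      SimpleGraph.degree (Q G₁) x + G₂.∑ᵥ (const (𝟙 (_∈I? G₁ x))) ∎
      where open ≡-Reasoning

  degree-∨Q-vertex : ∀ v → J.degree (inj₁ (inj₁ v)) ≡ G₁.degree v
  degree-∨Q-vertex v = trans (degree-Q-part (inj₁ v))
    (trans (cong₂ _+_ (degree-Q-vertex G₁ v) (∑-zero G₂.vertices (const refl))) (+-identityʳ _))

  degree-∨Q-edge : ∀ e → J.degree (inj₁ (inj₂ e)) ≡ G₁.degree (start G₁ e) + G₁.degree (end G₁ e) + G₂.order
  degree-∨Q-edge e = trans (degree-Q-part (inj₂ e)) (cong₂ _+_ (degree-Q-edge G₁ e)
    (trans (∑-const G₂.vertices 1) (trans (*-identityʳ _) (length-vertices G₂))))

  degree-∨Q-right : ∀ v → J.degree (inj₂ v) ≡ G₂.degree v + G₁.size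
  degree-∨Q-right v = begin
    J.degree (inj₂ v)
      ≡⟨ length-filter (JoinAdj? G₁ G₂ (inj₂ v)) J.vertices ⟩
    J.∑ᵥ (𝟙 ∘ JoinAdj? G₁ G₂ (inj₂ v))
      ≡⟨ ∑ᵥ-∨Q _ ⟩
    -- The indicators reduce by computation: original vertices of `G₁` are not joined to `v`, and
    -- every new vertex is.
    G₁.∑ᵥ (const 0) + ∑ (allFin G₁.size) (const 1) + G₂.∑ᵥ (𝟙 ∘ G₂.Adj? v)
      ≡⟨ cong₂ _+_ (cong₂ _+_ (∑-zero G₁.vertices (const refl)) (∑-const (allFin G₁.size) 1))
           (sym (degree-∑ G₂ v)) ⟩
    length (allFin G₁.size) * 1 + G₂.degree v
      ≡⟨ cong (_+ G₂.degree v) (trans (*-identityʳ _) (length-tabulate {n = G₁.size} (λ e → e))) ⟩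
    G₁.size + G₂.degree v
      ≡⟨ +-comm G₁.size _ ⟩
    G₂.degree v + G₁.size ∎
    where open ≡-Reasoning

  F-∨Q : F (G₁ ∨Q G₂)
       ≡ F G₁ + G₁.∑ₑ (λ u v → (G₁.degree u + G₁.degree v + G₂.order) ^ 3)
         + G₂.∑ᵥ (λ v → (G₂.degree v + G₁.size) ^ 3)
  F-∨Q = trans (∑ᵥ-∨Q _) (cong₂ _+_
    (cong₂ _+_
      (∑-cong G₁.vertices λ v → cong (_^ 3) (degree-∨Q-vertex v))
      -- The sum over new vertices becomes an edge sum of `G₁`.
      (trans (∑-cong (allFin G₁.size) λ e → cong (_^ 3) (degree-∨Q-edge e)) (∑-lookup G₁.edges _)))
    (∑-cong G₂.vertices λ v → cong (_^ 3) (degree-∨Q-right v)))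

theorem6 : (G₁ G₂ : SimpleGraph) (n₁ n₂ m₁ m₂ : ℕ) →
    SimpleGraph.Connected G₁ →
    SimpleGraph.Connected G₂ →
    SimpleGraph.order G₁ ≡ n₁ →
    SimpleGraph.order G₂ ≡ n₂ →
    SimpleGraph.size G₁ ≡ m₁ →
    SimpleGraph.size G₂ ≡ m₂ →
    F (G₁ ∨Q G₂)
    ≡ F G₁ + F G₂ + 3 * n₂ ^ 2 * M₁ G₁ + 3 * m₁ * M₁ G₂ + M₄ G₁
    + 3 * n₂ * HM G₁ + 3 * ReZM G₁
    + m₁ ^ 2 * (6 * m₂ + m₁ * n₂) + m₁ * n₂ ^ 3
theorem6 G₁ G₂ _ n₂ m₁ m₂ _ _ _ refl refl refl =
  trans (F-∨Q G₁ G₂)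
    (trans (cong₂ (λ x y → F G₁ + x + y) (∑ₑ-cubes G₁ n₂) (∑ᵥ-cubes G₂ m₁))
      (collect (F G₁) (F G₂) (M₁ G₁) (M₁ G₂) (M₄ G₁) (HM G₁) (ReZM G₁) n₂ m₁ m₂))
  where
  -- The factor `m ^ 2 * (6 * k + m * n)` gathers the linear and constant terms contributed by the
  -- second graph.
  collect : ∀ f₁ f₂ a₁ a₂ b h r n m k →
    f₁ + (b + 3 * r + 3 * n * h + 3 * n ^ 2 * a₁ + m * n ^ 3)
       + (f₂ + 3 * m * a₂ + 3 * m ^ 2 * (2 * k) + n * m ^ 3)
    ≡ f₁ + f₂ + 3 * n ^ 2 * a₁ + 3 * m * a₂ + b + 3 * n * h + 3 * r
      + m ^ 2 * (6 * k + m * n) + m * n ^ 3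
  collect = solve 10 (λ f₁ f₂ a₁ a₂ b h r n m k →
    f₁ :+ (b :+ con 3 :* r :+ con 3 :* n :* h :+ con 3 :* n :^ 2 :* a₁ :+ m :* n :^ 3)
       :+ (f₂ :+ con 3 :* m :* a₂ :+ con 3 :* m :^ 2 :* (con 2 :* k) :+ n :* m :^ 3)
    := f₁ :+ f₂ :+ con 3 :* n :^ 2 :* a₁ :+ con 3 :* m :* a₂ :+ b :+ con 3 :* n :* h :+ con 3 :* r
       :+ m :^ 2 :* (con 6 :* k :+ m :* n) :+ m :* n :^ 3) refl
    where open +-*-Solver
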